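{- There exists an absolute constant $c>0$ such that for all primes $q$, $$\mathrm{IM}(2,q)\ \ge\ c\,q^{1.2334}.$$
   Context: For an integer $d\ge 1$ and a prime power $q$, $\mathrm{IM}(d,q)$ denotes the maximum size of an induced matching in the bipartite point-line incidence graph of $\mathbb{F}_q^d$ (points of $\mathbb{F}_q^d$ on one side, affine lines of $\mathbb{F}_q^d$ on the other, a point adjacent to a line iff it lies on it). Equivalently, $\mathrm{IM}(d,q)$ is the largest $m$ for which there exist pairs $(p_1,\ell_1),\dots,(p_m,\ell_m)$ with $p_i\in\mathbb{F}_q^d$ points and $\ell_j\subset\mathbb{F}_q^d$ affine lines such that $p_i\in\ell_j$ if and only if $i=j$. -}

module Defs where

open import Algebra.Definitions.RawSemiring using (_^_)
open import Data.Fin.Base using (Fin; toℕ; funToFin; finToFun)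
open import Data.Fin.Properties as Fin using (any?; all?; finToFun-funToFin; injective⇒≤)
open import Data.Integer.Base using (+_)
open import Data.Nat.Base as ℕ using (ℕ; zero; suc; NonZero)
open import Data.Nat.DivMod using (_mod_)
open import Data.Nat.Primality using (Prime; prime⇒nonZero)
import Data.Nat.Properties as ℕ
open import Data.Product.Base using (_×_; _,_; ∃; ∃₂; ∃-syntax; proj₁; proj₂)
open import Data.Rational.Base as ℚ using (ℚ)
open import Data.Vec.Base using (Vec; []; _∷_; lookup; tabulate; replicate; zipWith; map)
open import Data.Vec.Properties using (≡-dec; lookup∘tabulate; tabulate∘lookup; tabulate-cong)
open import Function.Base using (_∘_)
open import Function.Bundles using (_⇔_; mk⇔; Equivalence)
open import Level using (Level; 0ℓ)
open import Relation.Binary.Core using (REL)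
open import Relation.Binary.PropositionalEquality
open import Relation.Nullary using (Dec; yes; no; ¬_; ¬?)
open import Relation.Nullary.Decidable using (map′; _×-dec_; _→-dec_)
open import Relation.Unary using (Pred; Decidable)

-- A bipartite graph is given by its adjacency relation A → B → Set.
-- The vertices a₀,…,aₘ₋₁ (and likewise the bⱼ) are automatically distinct.
IsInducedMatching : {A B : Set} → REL A B 0ℓ → {m : ℕ} → (Fin m → A) → (Fin m → B) → Set
IsInducedMatching _~_ a b = ∀ i j → (a i ~ b j) ⇔ (i ≡ j)

HasInducedMatching : {A B : Set} → REL A B 0ℓ → ℕ → Set
HasInducedMatching {A} {B} _~_ m =
  ∃₂ λ (a : Fin m → A) (b : Fin m → B) → IsInducedMatching _~_ a b

IsMaximum : Pred ℕ 0ℓ → ℕ → Set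
IsMaximum P n = P n × (∀ m → P m → m ℕ.≤ n)

-- The ring ℤ/qℤ on Fin q; it is the field 𝔽_q exactly when q is prime.
module AffineSpace (q : ℕ) .{{_ : NonZero q}} where

  𝔽 : Set
  𝔽 = Fin q

  infixl 6 _+_
  infixl 7 _*_

  _+_ _*_ : 𝔽 → 𝔽 → 𝔽
  x + y = (toℕ x ℕ.+ toℕ y) mod q
  x * y = (toℕ x ℕ.* toℕ y) mod q

  0# : 𝔽
  0# = 0 mod q

  Point : ℕ → Set
  Point d = Vec 𝔽 d

  -- Presents the line { base + t · direction ∣ t ∈ 𝔽 }.  A line has many
  -- presentations, but they all have the same incident points, and the lines
  -- of an induced matching are pairwise different as point sets.
  record Line (d : ℕ) : Set where
    constructor line
    field
      base       : Point d
      direction  : Point d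
      direction≢0 : direction ≢ replicate d 0#

  _∈ˡ_ : {d : ℕ} → Point d → Line d → Set
  p ∈ˡ line b v _ = ∃[ t ] p ≡ zipWith _+_ b (map (t *_) v)

------------------------------------------------------------------------
-- Existence of a largest induced matching

private
  Searchable : Set → Set₁
  Searchable A = {P : Pred A 0ℓ} → Decidable P → Dec (∃ P)

  searchVec : {A : Set} → Searchable A → ∀ n → Searchable (Vec A n)
  searchVec s zero    P? = map′ ([] ,_) (λ { ([] , p) → p }) (P? [])
  searchVec s (suc n) P? =
    map′ (λ { (x , xs , p) → x ∷ xs , p }) (λ { (x ∷ xs , p) → x , xs , p })
         (s λ x → searchVec s n (P? ∘ (x ∷_)))

  _⇔?_ : {A B : Set} → Dec A → Dec B → Dec (A ⇔ B)
  A? ⇔? B? =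
    map′ (λ (f , g) → mk⇔ f g) (λ e → Equivalence.to e , Equivalence.from e)
         ((A? →-dec B?) ×-dec (B? →-dec A?))

  module _ {A B : Set} (sA : Searchable A) (sB : Searchable B)
           {_~_ : REL A B 0ℓ} (_~?_ : ∀ a b → Dec (a ~ b)) where

    hasInducedMatching? : Decidable (HasInducedMatching _~_)
    hasInducedMatching? m =
      map′ (λ (as , bs , h) → lookup as , lookup bs , h)
           (λ (a , b , h) → tabulate a , tabulate b , λ i j →
             subst₂ (λ x y → (x ~ y) ⇔ (i ≡ j))
                    (sym (lookup∘tabulate a i)) (sym (lookup∘tabulate b j)) (h i j))
           (searchVec sA m λ as → searchVec sB m λ bs →
             all? λ i → all? λ j →
               (lookup as i ~? lookup bs j) ⇔? (i Fin.≟ j))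

  maximum : {P : Pred ℕ 0ℓ} → Decidable P → P 0 →
            ∀ N → (∀ m → P m → m ℕ.≤ N) → ∃ (IsMaximum P)
  maximum P? p₀ zero    bound = 0 , p₀ , bound
  maximum P? p₀ (suc N) bound with P? (suc N)
  ... | yes p = suc N , p , bound
  ... | no ¬p = maximum P? p₀ N λ m p →
    ℕ.s≤s⁻¹ (ℕ.≤∧≢⇒< (bound m p) λ { refl → ¬p p })

module _ (q : ℕ) .{{_ : NonZero q}} (d : ℕ) where
  open AffineSpace q

  private
    searchPoint : Searchable (Point d)
    searchPoint = searchVec any? d

    searchLine : Searchable (Line d)
    searchLine {P} P? =
      map′ (λ { (b , v , v≢0 , p) → line b v v≢0 , p })
           (λ { (line b v v≢0 , p) → b , v , v≢0 , p })
           (searchPoint λ b → searchPoint λ v → valid? b v)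
      where
      valid? : ∀ b v → Dec (∃ λ v≢0 → P (line b v v≢0))
      valid? b v with ≡-dec Fin._≟_ v (replicate d 0#)
      ... | yes v≡0 = no λ (v≢0 , _) → v≢0 v≡0
      ... | no  v≢0 = map′ (v≢0 ,_) proj₂ (P? (line b v v≢0))

    _∈ˡ?_ : (p : Point d) (ℓ : Line d) → Dec (p ∈ˡ ℓ)
    p ∈ˡ? line b v _ = any? λ t → ≡-dec Fin._≟_ p (zipWith _+_ b (map (t *_) v))

    funToFin-lookup-injective : {u v : Point d} →
      funToFin (lookup u) ≡ funToFin (lookup v) → u ≡ v
    funToFin-lookup-injective {u} {v} eq = begin
      u                    ≡⟨ tabulate∘lookup u ⟨
      tabulate (lookup u)  ≡⟨ tabulate-cong lookup-eq ⟩
      tabulate (lookup v)  ≡⟨ tabulate∘lookup v ⟩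
      v                    ∎
      where
      open ≡-Reasoning
      lookup-eq : ∀ i → lookup u i ≡ lookup v i
      lookup-eq i = begin
        lookup u i                        ≡⟨ finToFun-funToFin (lookup u) i ⟨
        finToFun (funToFin (lookup u)) i  ≡⟨ cong (λ k → finToFun k i) eq ⟩
        finToFun (funToFin (lookup v)) i  ≡⟨ finToFun-funToFin (lookup v) i ⟩
        lookup v i                        ∎

    size≤#points : ∀ m → HasInducedMatching (_∈ˡ_ {d}) m → m ℕ.≤ q ℕ.^ d
    size≤#points m (p , ℓ , h) = injective⇒≤ {f = funToFin ∘ lookup ∘ p} λ {i} {j} eq →
      Equivalence.to (h i j)
        (subst (_∈ˡ ℓ j) (sym (funToFin-lookup-injective eq)) (Equivalence.from (h j j) refl))

  -- Abstract so that type checking never runs the exhaustive search.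
  abstract
    largestInducedMatching : ∃ (IsMaximum (HasInducedMatching (_∈ˡ_ {d})))
    largestInducedMatching =
      maximum (hasInducedMatching? searchPoint searchLine _∈ˡ?_)
              ((λ ()) , (λ ()) , λ ())
              (q ℕ.^ d) size≤#points

------------------------------------------------------------------------

IM : (d q : ℕ) → Prime q → ℕ
IM d q q-prime = proj₁ (largestInducedMatching q {{prime⇒nonZero q-prime}} d)

IM-isMaximum : (d q : ℕ) (q-prime : Prime q) →
  let open AffineSpace q {{prime⇒nonZero q-prime}} in
  IsMaximum (HasInducedMatching (_∈ˡ_ {d})) (IM d q q-prime)
IM-isMaximum d q q-prime = proj₂ (largestInducedMatching q {{prime⇒nonZero q-prime}} d)

infixr 8 _^ℚ_
_^ℚ_ : ℚ → ℕ → ℚ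
_^ℚ_ = _^_ ℚ.+-*-rawSemiring

-- The real inequality c · x^(s/t) ≤ y for c ≥ 0, with both (nonnegative) sides
-- raised to the t-th power so that no irrational number occurs.
_·_^[_/_]≤_ : (c : ℚ) (x s t : ℕ) .{{_ : NonZero t}} (y : ℕ) → Set
c · x ^[ s / t ]≤ y = (c ^ℚ t) ℚ.* (+ (x ℕ.^ s) ℚ./ 1) ℚ.≤ (+ (y ℕ.^ t) ℚ./ 1)

{-# OPTIONS --safe #-}
-- Tangents to translated parabolas meet each other's points only along square
-- differences: (x , x² + c) lies on the tangent of y = x² + c′ at x′ iff
-- (x − x′)² = c′ − c.  Let x range over an interval of length about √q and c over
-- a subset C of an interval of length about q/2; then this equation in 𝔽_q is one
-- in ℤ, and it is enough that C has no nonzero square differences.  Ruzsa's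
-- construction, with the 12 residues modulo 205 of Beigel and Gasarch, gives
-- ∣C∣ of order q^γ with γ = (1 + log 12 / log 205) / 2 = 0.73341….
module Submission where

open import Defs
open import Data.Nat.Base using (ℕ)
open import Data.Nat.Primality using (Prime)
open import Data.Product.Base using (_×_; ∃-syntax)
open import Data.Rational.Base using (ℚ; 0ℚ; _<_)

open import Data.Fin.Base using (Fin; toℕ; combine; remQuot)
open import Data.Fin using (#_)
import Data.Fin.Properties as Fin
open import Data.Integer.Base as ℤ using (+_; -[1+_]; ∣_∣)
open import Data.Integer.Divisibility.Signed as ℤ using (divides)
import Data.Integer.Properties as ℤ
import Data.Integer.Tactic.RingSolver as ℤ-Solver
open import Data.Nat.Base as ℕ using (zero; suc; NonZero; _%_)
open import Data.Nat.DivMod using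
  (_mod_; m≡m%n+[m/n]*n; m%n<n; m<n⇒m%n≡m; %-distribˡ-+; %-distribˡ-*; %-remove-+ʳ)
import Data.Nat.Divisibility as ℕ
open import Data.Nat.LCM using (lcm-least)
open import Data.Nat.Primality using (prime⇒nonZero; prime⇒nonTrivial; prime?; euclidsLemma)
import Data.Nat.Properties as ℕ
import Data.Nat.Tactic.RingSolver as ℕ-Solver
open import Data.Product.Base using (_,_; proj₁; proj₂; uncurry)
import Data.Rational.Base as ℚ
import Data.Rational.Properties as ℚ
open import Data.Rational.Unnormalised.Base as ℚᵘ using (mkℚᵘ)
import Data.Rational.Unnormalised.Properties as ℚᵘ
open import Data.Sum.Base using (reduce)
open import Data.Unit.Base using (tt)
open import Data.Vec.Base using (Vec; []; _∷_; lookup; head; tail)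
open import Function.Base using (_∘_)
open import Function.Bundles using (mk⇔)
open import Relation.Binary.PropositionalEquality
open import Relation.Nullary using (yes; no; contradiction)
open import Relation.Nullary.Decidable using (toWitness; _→-dec_)

-- Reducing the rational inequality to one between natural numbers

ℕ→ℚ : ℕ → ℚ
ℕ→ℚ n = + n ℚ./ 1

toℚᵘ-ℕ→ℚ : ∀ n → ℚ.toℚᵘ (ℕ→ℚ n) ℚᵘ.≃ mkℚᵘ (+ n) 0
toℚᵘ-ℕ→ℚ n = ℚ.toℚᵘ-fromℚᵘ (mkℚᵘ (+ n) 0)

ℕ→ℚ-* : ∀ m n → ℕ→ℚ (m ℕ.* n) ≡ ℕ→ℚ m ℚ.* ℕ→ℚ n
ℕ→ℚ-* m n = ℚ.toℚᵘ-injective (begin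
  ℚ.toℚᵘ (ℕ→ℚ (m ℕ.* n))                    ≈⟨ toℚᵘ-ℕ→ℚ (m ℕ.* n) ⟩
  mkℚᵘ (+ (m ℕ.* n)) 0                      ≡⟨ cong (λ i → mkℚᵘ i 0) (ℤ.pos-* m n) ⟩
  mkℚᵘ (+ m) 0 ℚᵘ.* mkℚᵘ (+ n) 0            ≈⟨ ℚᵘ.*-cong (toℚᵘ-ℕ→ℚ m) (toℚᵘ-ℕ→ℚ n) ⟨
  ℚ.toℚᵘ (ℕ→ℚ m) ℚᵘ.* ℚ.toℚᵘ (ℕ→ℚ n)        ≈⟨ ℚ.toℚᵘ-homo-* (ℕ→ℚ m) (ℕ→ℚ n) ⟨
  ℚ.toℚᵘ (ℕ→ℚ m ℚ.* ℕ→ℚ n)                  ∎)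
  where open ℚᵘ.≃-Reasoning

ℕ→ℚ-mono-≤ : ∀ {m n} → m ℕ.≤ n → ℕ→ℚ m ℚ.≤ ℕ→ℚ n
ℕ→ℚ-mono-≤ {m} {n} m≤n = ℚ.toℚᵘ-cancel-≤ (begin
  ℚ.toℚᵘ (ℕ→ℚ m)  ≃⟨ toℚᵘ-ℕ→ℚ m ⟩
  mkℚᵘ (+ m) 0    ≤⟨ ℚᵘ.*≤* (ℤ.*-monoʳ-≤-nonNeg (+ 1) (ℤ.+≤+ m≤n)) ⟩
  mkℚᵘ (+ n) 0    ≃⟨ toℚᵘ-ℕ→ℚ n ⟨
  ℚ.toℚᵘ (ℕ→ℚ n)  ∎)
  where open ℚᵘ.≤-Reasoning

module _ (K : ℕ) .{{_ : NonZero K}} where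

  private instance
    K-positive : ℚ.Positive (ℕ→ℚ K)
    K-positive = ℚ.normalize-pos K 1

    K-nonZero : ℚ.NonZero (ℕ→ℚ K)
    K-nonZero = ℚ.pos⇒nonZero (ℕ→ℚ K)

    K⁻¹-positive : ℚ.Positive (ℚ.1/ ℕ→ℚ K)
    K⁻¹-positive = ℚ.1/pos⇒pos (ℕ→ℚ K)

  reciprocal : ℚ
  reciprocal = ℚ.1/ ℕ→ℚ K

  reciprocal>0 : 0ℚ < reciprocal
  reciprocal>0 = ℚ.positive⁻¹ reciprocal

  reciprocal-* : ∀ n → reciprocal ℚ.* ℕ→ℚ (K ℕ.* n) ≡ ℕ→ℚ n
  reciprocal-* n = begin
    reciprocal ℚ.* ℕ→ℚ (K ℕ.* n)         ≡⟨ cong (reciprocal ℚ.*_) (ℕ→ℚ-* K n) ⟩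
    reciprocal ℚ.* (ℕ→ℚ K ℚ.* ℕ→ℚ n)     ≡⟨ ℚ.*-assoc reciprocal (ℕ→ℚ K) (ℕ→ℚ n) ⟨
    reciprocal ℚ.* ℕ→ℚ K ℚ.* ℕ→ℚ n       ≡⟨ cong (ℚ._* ℕ→ℚ n) (ℚ.*-inverseˡ (ℕ→ℚ K)) ⟩
    ℚ.1ℚ ℚ.* ℕ→ℚ n                       ≡⟨ ℚ.*-identityˡ (ℕ→ℚ n) ⟩
    ℕ→ℚ n                                ∎
    where open ≡-Reasoning

  reciprocal^-nonNeg : ∀ t → ℚ.NonNegative (reciprocal ^ℚ t)
  reciprocal^-nonNeg zero    = _
  reciprocal^-nonNeg (suc t) =
    ℚ.nonNeg*nonNeg⇒nonNeg reciprocal {{ℚ.pos⇒nonNeg reciprocal}}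
                           (reciprocal ^ℚ t) {{reciprocal^-nonNeg t}}

  reciprocal^-* : ∀ t n → reciprocal ^ℚ t ℚ.* ℕ→ℚ (K ℕ.^ t ℕ.* n) ≡ ℕ→ℚ n
  reciprocal^-* zero    n = trans (ℚ.*-identityˡ _) (cong ℕ→ℚ (ℕ.*-identityˡ n))
  reciprocal^-* (suc t) n = begin
    c ℚ.* c ^ℚ t ℚ.* ℕ→ℚ (K ℕ.* K ℕ.^ t ℕ.* n)
      ≡⟨ ℚ.*-assoc c (c ^ℚ t) _ ⟩
    c ℚ.* (c ^ℚ t ℚ.* ℕ→ℚ (K ℕ.* K ℕ.^ t ℕ.* n))
      ≡⟨ cong (λ x → c ℚ.* (c ^ℚ t ℚ.* ℕ→ℚ x)) (commute K (K ℕ.^ t) n) ⟩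
    c ℚ.* (c ^ℚ t ℚ.* ℕ→ℚ (K ℕ.^ t ℕ.* (K ℕ.* n)))
      ≡⟨ cong (c ℚ.*_) (reciprocal^-* t (K ℕ.* n)) ⟩
    c ℚ.* ℕ→ℚ (K ℕ.* n)
      ≡⟨ reciprocal-* n ⟩
    ℕ→ℚ n
      ∎
    where
    open ≡-Reasoning
    c = reciprocal
    commute : ∀ a b n → a ℕ.* b ℕ.* n ≡ b ℕ.* (a ℕ.* n)
    commute = ℕ-Solver.solve-∀

  -- With `c = 1/K` the factor `c ^ t` cancels `K ^ t`, so the required bound follows from an
  -- inequality in ℕ and no further rational arithmetic arises.
  reciprocal·x^[s/t]≤y : ∀ {x s t y} .{{_ : NonZero t}} →
    x ℕ.^ s ℕ.≤ K ℕ.^ t ℕ.* y ℕ.^ t → reciprocal · x ^[ s / t ]≤ y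
  reciprocal·x^[s/t]≤y {x} {s} {t} {y} x^s≤K^t*y^t = begin
    reciprocal ^ℚ t ℚ.* ℕ→ℚ (x ℕ.^ s)
      ≤⟨ ℚ.*-monoˡ-≤-nonNeg (reciprocal ^ℚ t) {{reciprocal^-nonNeg t}} (ℕ→ℚ-mono-≤ x^s≤K^t*y^t) ⟩
    reciprocal ^ℚ t ℚ.* ℕ→ℚ (K ℕ.^ t ℕ.* y ℕ.^ t)
      ≡⟨ reciprocal^-* t (y ℕ.^ t) ⟩
    ℕ→ℚ (y ℕ.^ t)
      ∎
    where open ℚ.≤-Reasoning

-- Integer sets without square differences

NoSquareDifference : {A : Set} → (A → ℕ) → Set
NoSquareDifference f = ∀ i j s → f i ≡ f j ℕ.+ s ℕ.* s → i ≡ j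

remQuot-injective : ∀ {m} n (i j : Fin (m ℕ.* n)) → remQuot {m} n i ≡ remQuot {m} n j → i ≡ j
remQuot-injective {m} n i j eq = begin
  i                            ≡⟨ Fin.combine-remQuot {m} n i ⟨
  uncurry combine (remQuot {m} n i)  ≡⟨ cong (uncurry combine) eq ⟩
  uncurry combine (remQuot {m} n j)  ≡⟨ Fin.combine-remQuot {m} n j ⟩
  j                            ∎
  where open ≡-Reasoning

-- If distinct elements of R never differ by a square modulo m, and m is squarefree,
-- then the integers whose base-m digits at even positions lie in R have no nonzero
-- square differences: lowest digits agree, so m ∣ s and m² ∣ s², and the two
-- lowest digits can be stripped.
module Ruzsa
  {m ρ : ℕ} .{{_ : NonZero m}} (R : Fin ρ → Fin m)
  (R-noSquare : ∀ r r′ u → toℕ (R r) ≡ (toℕ (R r′) ℕ.+ u ℕ.* u) % m → r ≡ r′)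
  (m∣u²⇒m∣u : ∀ u → m ℕ.∣ u ℕ.* u → m ℕ.∣ u)
  where

  -- One base-`ρ * m` digit of the index encodes two base-`m` digits of the value: `r` selects an
  -- element of `R` for the even position, and `t` is a free digit for the odd one. This yields
  -- `(ρ * m) ^ k` indices for values below `(m * m) ^ k`.
  digits : ∀ k → Fin ((ρ ℕ.* m) ℕ.^ k) → ℕ
  digits zero    _ = 0
  digits (suc k) i with d , h ← remQuot {ρ ℕ.* m} ((ρ ℕ.* m) ℕ.^ k) i
                   with r , t ← remQuot {ρ} m d =
    toℕ (R r) ℕ.+ m ℕ.* (toℕ t ℕ.+ m ℕ.* digits k h)

  lowDigit-≡ : ∀ {a b : Fin m} {x y} → toℕ a ℕ.+ m ℕ.* x ≡ toℕ b ℕ.+ m ℕ.* y → a ≡ b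
  lowDigit-≡ {a} {b} {x} {y} eq = Fin.toℕ-injective (begin
    toℕ a                      ≡⟨ low a x ⟨
    (toℕ a ℕ.+ m ℕ.* x) % m    ≡⟨ cong (_% m) eq ⟩
    (toℕ b ℕ.+ m ℕ.* y) % m    ≡⟨ low b y ⟩
    toℕ b                      ∎)
    where
    open ≡-Reasoning
    low : ∀ (c : Fin m) z → (toℕ c ℕ.+ m ℕ.* z) % m ≡ toℕ c
    low c z = trans (%-remove-+ʳ (toℕ c) (ℕ.m∣m*n z)) (m<n⇒m%n≡m (Fin.toℕ<n c))

  private
    extractSquare : ∀ a b y v m →
      a ℕ.+ m ℕ.* (b ℕ.+ m ℕ.* y) ℕ.+ v ℕ.* m ℕ.* (v ℕ.* m) ≡
      a ℕ.+ m ℕ.* (b ℕ.+ m ℕ.* (y ℕ.+ v ℕ.* v))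
    extractSquare = ℕ-Solver.solve-∀

  step : ∀ {r r′ t t′} x y s →
    toℕ (R r) ℕ.+ m ℕ.* (toℕ t ℕ.+ m ℕ.* x) ≡
      toℕ (R r′) ℕ.+ m ℕ.* (toℕ {m} t′ ℕ.+ m ℕ.* y) ℕ.+ s ℕ.* s →
    r ≡ r′ × t ≡ t′ × ∃[ v ] x ≡ y ℕ.+ v ℕ.* v
  step {r} {r′} {t} {t′} x y s eq with R-noSquare r r′ s residues
    where
    open ≡-Reasoning
    X = m ℕ.* (toℕ t ℕ.+ m ℕ.* x)
    Y = m ℕ.* (toℕ t′ ℕ.+ m ℕ.* y)
    move : ∀ a b c → a ℕ.+ b ℕ.+ c ≡ a ℕ.+ c ℕ.+ b
    move = ℕ-Solver.solve-∀
    residues : toℕ (R r) ≡ (toℕ (R r′) ℕ.+ s ℕ.* s) % m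
    residues = begin
      toℕ (R r)                                ≡⟨ m<n⇒m%n≡m (Fin.toℕ<n (R r)) ⟨
      toℕ (R r) % m                            ≡⟨ %-remove-+ʳ (toℕ (R r)) (ℕ.m∣m*n _) ⟨
      (toℕ (R r) ℕ.+ X) % m                    ≡⟨ cong (_% m) eq ⟩
      (toℕ (R r′) ℕ.+ Y ℕ.+ s ℕ.* s) % m       ≡⟨ cong (_% m) (move (toℕ (R r′)) Y (s ℕ.* s)) ⟩
      (toℕ (R r′) ℕ.+ s ℕ.* s ℕ.+ Y) % m       ≡⟨ %-remove-+ʳ _ (ℕ.m∣m*n _) ⟩
      (toℕ (R r′) ℕ.+ s ℕ.* s) % m             ∎
  ... | refl with m∣u²⇒m∣u s (ℕ.∣m+n∣m⇒∣n (subst (m ℕ.∣_) X≡Y+s² (ℕ.m∣m*n _)) (ℕ.m∣m*n _))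
    where
    X≡Y+s² : m ℕ.* (toℕ t ℕ.+ m ℕ.* x) ≡ m ℕ.* (toℕ t′ ℕ.+ m ℕ.* y) ℕ.+ s ℕ.* s
    X≡Y+s² = ℕ.+-cancelˡ-≡ (toℕ (R r)) _ _ (trans eq (ℕ.+-assoc (toℕ (R r)) _ _))
  -- Now `s = v * m`, so `s * s` is `m * m` times `v * v`: it does not affect the second digit,
  -- which is why that digit may be arbitrary, and it becomes `v * v` once both digits are stripped.
  ... | ℕ.divides-refl v with lowDigit-≡ {t} {t′} {y = y ℕ.+ v ℕ.* v} t+mx≡t′+m[y+v²]
    where
    t+mx≡t′+m[y+v²] : toℕ t ℕ.+ m ℕ.* x ≡ toℕ t′ ℕ.+ m ℕ.* (y ℕ.+ v ℕ.* v)
    t+mx≡t′+m[y+v²] = ℕ.*-cancelˡ-≡ _ _ m (ℕ.+-cancelˡ-≡ (toℕ (R r)) _ _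
      (trans eq (extractSquare (toℕ (R r)) (toℕ t′) y v m)))
  ... | refl = refl , refl , v , ℕ.*-cancelˡ-≡ _ _ m (ℕ.+-cancelˡ-≡ (toℕ t) _ _
      (ℕ.*-cancelˡ-≡ _ _ m (ℕ.+-cancelˡ-≡ (toℕ (R r)) _ _
        (trans eq (extractSquare (toℕ (R r)) (toℕ t) y v m)))))

  -- Induction on `k`, removing two digits at a time. The case `s = 0` is included, so `digits k` is
  -- also injective and its image has the full size `(ρ * m) ^ k`.
  digits-noSquareDifference : ∀ k → NoSquareDifference (digits k)
  digits-noSquareDifference zero    Fin.zero Fin.zero s eq = refl
  digits-noSquareDifference (suc k) i j s eq
    with r≡r′ , t≡t′ , v , eq′ ← step _ _ s eq =
    remQuot-injective {ρ ℕ.* m} _ i j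
      (cong₂ _,_ (remQuot-injective {ρ} m _ _ (cong₂ _,_ r≡r′ t≡t′))
                 (digits-noSquareDifference k _ _ v eq′))

  lowDigit-bound : ∀ {x N} (a : Fin m) → x ℕ.< N → toℕ a ℕ.+ m ℕ.* x ℕ.< m ℕ.* N
  lowDigit-bound {x} {N} a x<N = begin-strict
    toℕ a ℕ.+ m ℕ.* x  <⟨ ℕ.+-monoˡ-< (m ℕ.* x) (Fin.toℕ<n a) ⟩
    m ℕ.+ m ℕ.* x      ≡⟨ ℕ.*-suc m x ⟨
    m ℕ.* suc x        ≤⟨ ℕ.*-monoʳ-≤ m x<N ⟩
    m ℕ.* N            ∎
    where open ℕ.≤-Reasoning

  digits-bound : ∀ k i → digits k i ℕ.< (m ℕ.* m) ℕ.^ k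
  digits-bound zero    _ = ℕ.z<s
  digits-bound (suc k) i =
    subst (digits (suc k) i ℕ.<_) (sym (ℕ.*-assoc m m _))
      (lowDigit-bound (R _) (lowDigit-bound _ (digits-bound k _)))

-- From congruences modulo q to equations in ℤ

+∣i∣*∣i∣≡i*i : ∀ i → + (∣ i ∣ ℕ.* ∣ i ∣) ≡ i ℤ.* i
+∣i∣*∣i∣≡i*i (+ n)    = ℤ.pos-* n n
+∣i∣*∣i∣≡i*i -[1+ n ] = refl

module _ {q : ℕ} .{{_ : NonZero q}} where

  %-cong-∣ : ∀ {a b} → a % q ≡ b % q → + q ℤ.∣ + a ℤ.- + b
  %-cong-∣ {a} {b} a%q≡b%q = divides (+ (a ℕ./ q) ℤ.- + (b ℕ./ q)) (begin
    + a ℤ.- + b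
      ≡⟨ cong₂ ℤ._-_ (split a) (split b) ⟩
    + (a % q) ℤ.+ + (a ℕ./ q) ℤ.* + q ℤ.- (+ (b % q) ℤ.+ + (b ℕ./ q) ℤ.* + q)
      ≡⟨ cong (λ r → + r ℤ.+ + (a ℕ./ q) ℤ.* + q ℤ.- (+ (b % q) ℤ.+ + (b ℕ./ q) ℤ.* + q)) a%q≡b%q ⟩
    + (b % q) ℤ.+ + (a ℕ./ q) ℤ.* + q ℤ.- (+ (b % q) ℤ.+ + (b ℕ./ q) ℤ.* + q)
      ≡⟨ cancel (+ (b % q)) (+ (a ℕ./ q)) (+ (b ℕ./ q)) (+ q) ⟩
    (+ (a ℕ./ q) ℤ.- + (b ℕ./ q)) ℤ.* + q
      ∎)
    where
    open ≡-Reasoning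
    split : ∀ n → + n ≡ + (n % q) ℤ.+ + (n ℕ./ q) ℤ.* + q
    split n = trans (cong +_ (m≡m%n+[m/n]*n n q)) (cong (ℤ._+_ (+ (n % q))) (ℤ.pos-* (n ℕ./ q) q))
    cancel : ∀ r x y z → r ℤ.+ x ℤ.* z ℤ.- (r ℤ.+ y ℤ.* z) ≡ (x ℤ.- y) ℤ.* z
    cancel = ℤ-Solver.solve-∀

  -- The distance between two naturals is at most the larger one, hence below `q` here, and the only
  -- multiple of `q` that small is 0.
  ∣-<⇒≡ : ∀ {a b} → a ℕ.< q → b ℕ.< q → + q ℤ.∣ + a ℤ.- + b → a ≡ b
  ∣-<⇒≡ {a} {b} a<q b<q q∣a-b with ∣ + a ℤ.- + b ∣ in eq
  ... | zero  = ℤ.+-injective (ℤ.i-j≡0⇒i≡j (+ a) (+ b) (ℤ.∣i∣≡0⇒i≡0 eq))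
  ... | suc n = contradiction (subst (q ℕ.∣_) eq (ℤ.∣⇒∣ᵤ q∣a-b)) (ℕ.>⇒∤ (begin-strict
    suc n              ≡⟨ eq ⟨
    ∣ + a ℤ.- + b ∣    ≡⟨ cong ∣_∣ (ℤ.m-n≡m⊖n a b) ⟩
    ∣ a ℤ.⊖ b ∣        ≤⟨ ℤ.∣m⊝n∣≤m⊔n a b ⟩
    a ℕ.⊔ b            <⟨ ℕ.⊔-lub a<q b<q ⟩
    q                  ∎))
    where open ℕ.≤-Reasoning

-- Induced matchings from tangents to translated parabolas

module _ (q : ℕ) .{{_ : NonZero q}} (1<q : 1 ℕ.< q) where
  open AffineSpace q

  private
    toℕ-mod : ∀ a → toℕ (a mod q) ≡ a % q
    toℕ-mod a = Fin.toℕ-fromℕ< (m%n<n a q)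

    toℕ% : (x : 𝔽) → toℕ x ≡ toℕ x % q
    toℕ% x = sym (m<n⇒m%n≡m (Fin.toℕ<n x))

    -- Turns a coordinate of a point on a line into the residue of a single natural number, so that
    -- incidence becomes a pair of integer congruences.
    mod+*mod : ∀ a (t : 𝔽) b → a mod q + t * (b mod q) ≡ (a ℕ.+ toℕ t ℕ.* b) mod q
    mod+*mod a t b = Fin.toℕ-injective (begin
      toℕ (a mod q + t * (b mod q))
        ≡⟨ toℕ-mod _ ⟩
      (toℕ (a mod q) ℕ.+ toℕ (t * (b mod q))) % q
        ≡⟨ cong₂ (λ x y → (x ℕ.+ y) % q) (toℕ-mod a) t*b ⟩
      (a % q ℕ.+ toℕ t ℕ.* b % q) % q
        ≡⟨ %-distribˡ-+ a (toℕ t ℕ.* b) q ⟨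
      (a ℕ.+ toℕ t ℕ.* b) % q
        ≡⟨ toℕ-mod _ ⟨
      toℕ ((a ℕ.+ toℕ t ℕ.* b) mod q)
        ∎)
      where
      open ≡-Reasoning
      t*b : toℕ (t * (b mod q)) ≡ toℕ t ℕ.* b % q
      t*b = begin
        toℕ (t * (b mod q))              ≡⟨ toℕ-mod _ ⟩
        toℕ t ℕ.* toℕ (b mod q) % q      ≡⟨ cong₂ (λ x y → x ℕ.* y % q) (toℕ% t) (toℕ-mod b) ⟩
        toℕ t % q ℕ.* (b % q) % q        ≡⟨ %-distribˡ-* (toℕ t) b q ⟨
        toℕ t ℕ.* b % q                  ∎

    mod-≡⇒∣ : ∀ {a b} → a mod q ≡ b mod q → + q ℤ.∣ + a ℤ.- + b
    mod-≡⇒∣ {a} {b} eq = %-cong-∣ (trans (sym (toℕ-mod a)) (trans (cong toℕ eq) (toℕ-mod b)))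

    point : ℕ → ℕ → Point 2
    point x c = x mod q ∷ (x ℕ.* x ℕ.+ c) mod q ∷ []

    toℕ0#≡0 : toℕ 0# ≡ 0
    toℕ0#≡0 = trans (toℕ-mod 0) (m<n⇒m%n≡m (ℕ.>-nonZero⁻¹ q))

    1≢0 : 1 mod q ≢ 0#
    1≢0 eq = ℕ.1+n≢0 (begin
      1                 ≡⟨ m<n⇒m%n≡m 1<q ⟨
      1 % q             ≡⟨ toℕ-mod 1 ⟨
      toℕ (1 mod q)     ≡⟨ cong toℕ eq ⟩
      toℕ 0#            ≡⟨ toℕ0#≡0 ⟩
      0                 ∎)
      where open ≡-Reasoning

    tangent : ℕ → ℕ → Line 2
    tangent x c = line (point x c) (1 mod q ∷ (x ℕ.+ x) mod q ∷ []) (1≢0 ∘ cong head)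

    point∈tangent : ∀ x c → point x c ∈ˡ tangent x c
    point∈tangent x c = 0# ,
      sym (cong₂ (λ a b → a ∷ b ∷ []) (stay x 1) (stay (x ℕ.* x ℕ.+ c) (x ℕ.+ x)))
      where
      stay : ∀ a b → a mod q + 0# * (b mod q) ≡ a mod q
      stay a b = begin
        a mod q + 0# * (b mod q)       ≡⟨ mod+*mod a 0# b ⟩
        (a ℕ.+ toℕ 0# ℕ.* b) mod q     ≡⟨ cong (λ z → (a ℕ.+ z ℕ.* b) mod q) toℕ0#≡0 ⟩
        (a ℕ.+ 0) mod q                ≡⟨ cong (_mod q) (ℕ.+-identityʳ a) ⟩
        a mod q                        ∎
        where open ≡-Reasoning

    -- Subtracting `2x′` times the congruence of first coordinates from that of second coordinates
    -- eliminates the line parameter and completes the square. The absolute value expresses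
    -- `(x − x′)²` as the square of a natural number, as `NoSquareDifference` demands.
    ∈tangent⇒∣ : ∀ {x c x′ c′} → point x c ∈ˡ tangent x′ c′ →
      + q ℤ.∣ + (c ℕ.+ ∣ + x ℤ.- + x′ ∣ ℕ.* ∣ + x ℤ.- + x′ ∣) ℤ.- + c′
    ∈tangent⇒∣ {x} {c} {x′} {c′} (t , eq) =
      subst (+ q ℤ.∣_) combination (ℤ.∣m∣n⇒∣m-n q∣y-Y (ℤ.∣n⇒∣m*n (+ x′ ℤ.+ + x′) q∣x-X))
      where
      open ≡-Reasoning
      τ = toℕ t
      y = x ℕ.* x ℕ.+ c
      y′ = x′ ℕ.* x′ ℕ.+ c′
      X = x′ ℕ.+ τ ℕ.* 1
      Y = y′ ℕ.+ τ ℕ.* (x′ ℕ.+ x′)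

      q∣x-X : + q ℤ.∣ + x ℤ.- + X
      q∣x-X = mod-≡⇒∣ {x} (trans (cong head eq) (mod+*mod x′ t 1))

      q∣y-Y : + q ℤ.∣ + y ℤ.- + Y
      q∣y-Y = mod-≡⇒∣ {y} (trans (cong (head ∘ tail) eq) (mod+*mod y′ t (x′ ℕ.+ x′)))

      identity : ∀ x c x′ c′ t →
        x ℤ.* x ℤ.+ c ℤ.- (x′ ℤ.* x′ ℤ.+ c′ ℤ.+ t ℤ.* (x′ ℤ.+ x′))
          ℤ.- (x′ ℤ.+ x′) ℤ.* (x ℤ.- (x′ ℤ.+ t ℤ.* + 1)) ≡
        c ℤ.+ (x ℤ.- x′) ℤ.* (x ℤ.- x′) ℤ.- c′
      identity = ℤ-Solver.solve-∀

      combination :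
        + y ℤ.- + Y ℤ.- (+ x′ ℤ.+ + x′) ℤ.* (+ x ℤ.- + X) ≡
        + (c ℕ.+ ∣ + x ℤ.- + x′ ∣ ℕ.* ∣ + x ℤ.- + x′ ∣) ℤ.- + c′
      combination = begin
        + y ℤ.- + Y ℤ.- (+ x′ ℤ.+ + x′) ℤ.* (+ x ℤ.- + X)
          ≡⟨ cong₂ ℤ._-_
               (cong₂ ℤ._-_
                 (cong (ℤ._+ + c) (ℤ.pos-* x x))
                 (cong₂ ℤ._+_ (cong (ℤ._+ + c′) (ℤ.pos-* x′ x′)) (ℤ.pos-* τ (x′ ℕ.+ x′))))
               (cong (λ z → (+ x′ ℤ.+ + x′) ℤ.* (+ x ℤ.- (+ x′ ℤ.+ z))) (ℤ.pos-* τ 1)) ⟩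
        + x ℤ.* + x ℤ.+ + c ℤ.- (+ x′ ℤ.* + x′ ℤ.+ + c′ ℤ.+ + τ ℤ.* (+ x′ ℤ.+ + x′))
          ℤ.- (+ x′ ℤ.+ + x′) ℤ.* (+ x ℤ.- (+ x′ ℤ.+ + τ ℤ.* + 1))
          ≡⟨ identity (+ x) (+ c) (+ x′) (+ c′) (+ τ) ⟩
        + c ℤ.+ (+ x ℤ.- + x′) ℤ.* (+ x ℤ.- + x′) ℤ.- + c′
          ≡⟨ cong (λ z → + c ℤ.+ z ℤ.- + c′) (+∣i∣*∣i∣≡i*i (+ x ℤ.- + x′)) ⟨
        + (c ℕ.+ ∣ + x ℤ.- + x′ ∣ ℕ.* ∣ + x ℤ.- + x′ ∣) ℤ.- + c′
          ∎

  -- The abscissas lie below `X` and the shifts below `N`, so `c + s²` stays below `N + X² ≤ q` and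
  -- the congruence given by an incidence is an equality in ℕ. It exhibits two values of `f`
  -- differing by `s²`; their indices therefore agree, and then `s = 0`.
  noSquareDifference⇒inducedMatching : ∀ {X N M} (f : Fin M → ℕ) → NoSquareDifference f →
    (∀ i → f i ℕ.< N) → X ℕ.* X ℕ.+ N ℕ.≤ q → HasInducedMatching (_∈ˡ_ {2}) (X ℕ.* M)
  noSquareDifference⇒inducedMatching {X} {N} {M} f f-noSquareDifference f<N X²+N≤q =
    (λ i → point (x i) (c i)) , (λ i → tangent (x i) (c i)) ,
    λ i j → mk⇔ (distinct i j) λ { refl → point∈tangent (x i) (c i) }
    where
    ξ : Fin (X ℕ.* M) → Fin X
    ξ i = proj₁ (remQuot {X} M i)

    γ : Fin (X ℕ.* M) → Fin M
    γ i = proj₂ (remQuot {X} M i)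

    x c : Fin (X ℕ.* M) → ℕ
    x = toℕ ∘ ξ
    c = f ∘ γ

    distinct : ∀ i j → point (x i) (c i) ∈ˡ tangent (x j) (c j) → i ≡ j
    distinct i j on = remQuot-injective {X} M i j (cong₂ _,_ (Fin.toℕ-injective xᵢ≡xⱼ) (sym γⱼ≡γᵢ))
      where
      s = ∣ + x i ℤ.- + x j ∣

      s≤X : s ℕ.≤ X
      s≤X = begin
        s                  ≡⟨ cong ∣_∣ (ℤ.m-n≡m⊖n (x i) (x j)) ⟩
        ∣ x i ℤ.⊖ x j ∣    ≤⟨ ℤ.∣m⊝n∣≤m⊔n (x i) (x j) ⟩
        x i ℕ.⊔ x j        ≤⟨ ℕ.⊔-lub (Fin.toℕ≤n (ξ i)) (Fin.toℕ≤n (ξ j)) ⟩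
        X                  ∎
        where open ℕ.≤-Reasoning

      cᵢ+s²<q : c i ℕ.+ s ℕ.* s ℕ.< q
      cᵢ+s²<q = begin-strict
        c i ℕ.+ s ℕ.* s    <⟨ ℕ.+-mono-<-≤ (f<N (γ i)) (ℕ.*-mono-≤ s≤X s≤X) ⟩
        N ℕ.+ X ℕ.* X      ≡⟨ ℕ.+-comm N (X ℕ.* X) ⟩
        X ℕ.* X ℕ.+ N      ≤⟨ X²+N≤q ⟩
        q                  ∎
        where open ℕ.≤-Reasoning

      cⱼ<q : c j ℕ.< q
      cⱼ<q = ℕ.<-≤-trans (f<N (γ j)) (ℕ.≤-trans (ℕ.m≤n+m N (X ℕ.* X)) X²+N≤q)

      cⱼ≡cᵢ+s² : c j ≡ c i ℕ.+ s ℕ.* s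
      cⱼ≡cᵢ+s² = sym (∣-<⇒≡ cᵢ+s²<q cⱼ<q (∈tangent⇒∣ {x i} {c i} on))

      γⱼ≡γᵢ : γ j ≡ γ i
      γⱼ≡γᵢ = f-noSquareDifference (γ j) (γ i) s cⱼ≡cᵢ+s²

      s≡0 : s ≡ 0
      s≡0 = reduce (ℕ.m*n≡0⇒m≡0∨n≡0 s
        (ℕ.+-cancelˡ-≡ (c i) _ _ (trans (sym cⱼ≡cᵢ+s²) (trans (cong f γⱼ≡γᵢ) (sym (ℕ.+-identityʳ (c i)))))))

      xᵢ≡xⱼ : x i ≡ x j
      xᵢ≡xⱼ = ℤ.+-injective (ℤ.i-j≡0⇒i≡j (+ x i) (+ x j) (ℤ.∣i∣≡0⇒i≡0 s≡0))

-- Powers and the choice of scale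

^-distribʳ-* : ∀ m n k → (m ℕ.* n) ℕ.^ k ≡ m ℕ.^ k ℕ.* n ℕ.^ k
^-distribʳ-* m n zero    = refl
^-distribʳ-* m n (suc k) =
  trans (cong (m ℕ.* n ℕ.*_) (^-distribʳ-* m n k)) (ℕ.[m*n]*[o*p]≡[m*o]*[n*p] m n (m ℕ.^ k) (n ℕ.^ k))

^-swap : ∀ m a b → (m ℕ.^ a) ℕ.^ b ≡ (m ℕ.^ b) ℕ.^ a
^-swap m a b = trans (ℕ.^-*-assoc m a b) (trans (cong (m ℕ.^_) (ℕ.*-comm a b)) (sym (ℕ.^-*-assoc m b a)))

n<m^n : ∀ {m} → 1 ℕ.< m → ∀ n → n ℕ.< m ℕ.^ n
n<m^n 1<m zero = ℕ.z<s
n<m^n {m} 1<m (suc n) = ℕ.≤-<-trans (n<m^n 1<m n) (ℕ.^-monoʳ-< m 1<m (ℕ.n<1+n n))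

-- Searching downwards from `n`, the first index whose value is at most `q` is followed by a value
-- above `q`.
lastBelow : ∀ (f : ℕ → ℕ) {q} n → f 0 ℕ.≤ q → q ℕ.< f n → ∃[ k ] (f k ℕ.≤ q × q ℕ.< f (suc k))
lastBelow f zero    f0≤q q<fn = contradiction q<fn (ℕ.≤⇒≯ f0≤q)
lastBelow f {q} (suc n) f0≤q q<fn with f n ℕ.≤? q
... | yes fn≤q = n , fn≤q , q<fn
... | no  fn≰q = lastBelow f n f0≤q (ℕ.≰⇒> fn≰q)

-- The hypothesis `B ^ a ≤ ρ ^ t` means `ρ ≥ B^(a/t)`, so `(B * ρ) ^ k` is at least
-- `(B ^ k)^(1 + a/t)`, hence at least `(q / A)^(1 + a/t)`. Since `a ≤ t`, the loss `A^(1 + a/t)` is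
-- at most `A * A`. Everything is stated after raising to the power `t`.
growth : ∀ {B ρ a t} A k {q} → .{{_ : NonZero A}} → a ℕ.≤ t → B ℕ.^ a ℕ.≤ ρ ℕ.^ t → q ℕ.≤ A ℕ.* B ℕ.^ k →
  q ℕ.^ (t ℕ.+ a) ℕ.≤ (A ℕ.* A) ℕ.^ t ℕ.* ((B ℕ.* ρ) ℕ.^ k) ℕ.^ t
growth {B} {ρ} {a} {t} A k {q} a≤t B^a≤ρ^t q≤AB^k = begin
  q ℕ.^ (t ℕ.+ a)
    ≤⟨ ℕ.^-monoˡ-≤ (t ℕ.+ a) q≤AB^k ⟩
  (A ℕ.* B ℕ.^ k) ℕ.^ (t ℕ.+ a)
    ≡⟨ ^-distribʳ-* A (B ℕ.^ k) (t ℕ.+ a) ⟩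
  A ℕ.^ (t ℕ.+ a) ℕ.* (B ℕ.^ k) ℕ.^ (t ℕ.+ a)
    ≤⟨ ℕ.*-mono-≤ A-part B-part ⟩
  (A ℕ.* A) ℕ.^ t ℕ.* ((B ℕ.* ρ) ℕ.^ k) ℕ.^ t
    ∎
  where
  open ℕ.≤-Reasoning
  A-part : A ℕ.^ (t ℕ.+ a) ℕ.≤ (A ℕ.* A) ℕ.^ t
  A-part = begin
    A ℕ.^ (t ℕ.+ a)          ≤⟨ ℕ.^-monoʳ-≤ A (ℕ.+-monoʳ-≤ t a≤t) ⟩
    A ℕ.^ (t ℕ.+ t)          ≡⟨ ℕ.^-distribˡ-+-* A t t ⟩
    A ℕ.^ t ℕ.* A ℕ.^ t      ≡⟨ ^-distribʳ-* A A t ⟨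
    (A ℕ.* A) ℕ.^ t          ∎
  B-part : (B ℕ.^ k) ℕ.^ (t ℕ.+ a) ℕ.≤ ((B ℕ.* ρ) ℕ.^ k) ℕ.^ t
  B-part = begin
    (B ℕ.^ k) ℕ.^ (t ℕ.+ a)                  ≡⟨ ℕ.^-distribˡ-+-* (B ℕ.^ k) t a ⟩
    (B ℕ.^ k) ℕ.^ t ℕ.* (B ℕ.^ k) ℕ.^ a      ≡⟨ cong ((B ℕ.^ k) ℕ.^ t ℕ.*_) (^-swap B k a) ⟩
    (B ℕ.^ k) ℕ.^ t ℕ.* (B ℕ.^ a) ℕ.^ k      ≤⟨ ℕ.*-monoʳ-≤ ((B ℕ.^ k) ℕ.^ t) (ℕ.^-monoˡ-≤ k B^a≤ρ^t) ⟩
    (B ℕ.^ k) ℕ.^ t ℕ.* (ρ ℕ.^ t) ℕ.^ k      ≡⟨ cong ((B ℕ.^ k) ℕ.^ t ℕ.*_) (^-swap ρ t k) ⟩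
    (B ℕ.^ k) ℕ.^ t ℕ.* (ρ ℕ.^ k) ℕ.^ t      ≡⟨ ^-distribʳ-* (B ℕ.^ k) (ρ ℕ.^ k) t ⟨
    (B ℕ.^ k ℕ.* ρ ℕ.^ k) ℕ.^ t              ≡⟨ cong (ℕ._^ t) (^-distribʳ-* B ρ k) ⟨
    ((B ℕ.* ρ) ℕ.^ k) ℕ.^ t                  ∎

-- The lower bound for a general modulus and residue set

module _
  {m ρ : ℕ} (1<m : 1 ℕ.< m) (R : Fin ρ → Fin m) .{{_ : NonZero m}}
  (R-noSquare : ∀ r r′ u → toℕ (R r) ≡ (toℕ (R r′) ℕ.+ u ℕ.* u) % m → r ≡ r′)
  (m∣u²⇒m∣u : ∀ u → m ℕ.∣ u ℕ.* u → m ℕ.∣ u)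
  where
  open Ruzsa R R-noSquare m∣u²⇒m∣u

  -- Take `m ^ k` abscissas and the `(ρ * m) ^ k` shifts `digits k`, all below `(m * m) ^ k`. The
  -- squared abscissa range equals the shift range, which accounts for the factor 2.
  IM≥[m²ρ]^k : ∀ {q} (q-prime : Prime q) k → 2 ℕ.* (m ℕ.* m) ℕ.^ k ℕ.≤ q →
    (m ℕ.* m ℕ.* ρ) ℕ.^ k ℕ.≤ IM 2 q q-prime
  IM≥[m²ρ]^k {q} q-prime k 2m²ᵏ≤q = subst (ℕ._≤ IM 2 q q-prime) size
    (proj₂ (IM-isMaximum 2 q q-prime) _
      (noSquareDifference⇒inducedMatching q {{prime⇒nonZero q-prime}}
        (ℕ.nonTrivial⇒n>1 q {{prime⇒nonTrivial q-prime}}) {X = m ℕ.^ k}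
        (digits k) (digits-noSquareDifference k) (digits-bound k)
        (subst (ℕ._≤ q) double 2m²ᵏ≤q)))
    where
    open ≡-Reasoning
    double : 2 ℕ.* (m ℕ.* m) ℕ.^ k ≡ m ℕ.^ k ℕ.* m ℕ.^ k ℕ.+ (m ℕ.* m) ℕ.^ k
    double = cong₂ ℕ._+_ (^-distribʳ-* m m k) (ℕ.+-identityʳ _)
    size : m ℕ.^ k ℕ.* (ρ ℕ.* m) ℕ.^ k ≡ (m ℕ.* m ℕ.* ρ) ℕ.^ k
    size = begin
      m ℕ.^ k ℕ.* (ρ ℕ.* m) ℕ.^ k    ≡⟨ ^-distribʳ-* m (ρ ℕ.* m) k ⟨
      (m ℕ.* (ρ ℕ.* m)) ℕ.^ k        ≡⟨ cong (λ n → (m ℕ.* n) ℕ.^ k) (ℕ.*-comm ρ m) ⟩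
      (m ℕ.* (m ℕ.* ρ)) ℕ.^ k        ≡⟨ cong (ℕ._^ k) (ℕ.*-assoc m m ρ) ⟨
      (m ℕ.* m ℕ.* ρ) ℕ.^ k          ∎

  IM-lowerBound : ∀ {a t} .{{_ : NonZero t}} → a ℕ.≤ t → (m ℕ.* m) ℕ.^ a ℕ.≤ ρ ℕ.^ t →
    ∃[ c ] (0ℚ < c × ((q : ℕ) (q-prime : Prime q) → c · q ^[ t ℕ.+ a / t ]≤ IM 2 q q-prime))
  IM-lowerBound {a} {t} a≤t m²ᵃ≤ρᵗ = reciprocal K , reciprocal>0 K , bound
    where
    B A K : ℕ
    B = m ℕ.* m
    -- Chosen so that `q < 2 * B ^ (k + 1)` reads `q < A * B ^ k`; then `K = A * A` is the loss in
    -- `growth`.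
    A = 2 ℕ.* B
    K = A ℕ.* A

    instance
      B-nonZero : NonZero B
      B-nonZero = ℕ.m*n≢0 m m
      A-nonZero : NonZero A
      A-nonZero = ℕ.m*n≢0 2 B
      K-nonZero : NonZero K
      K-nonZero = ℕ.m*n≢0 A A

    1<B : 1 ℕ.< B
    1<B = ℕ.*-mono-≤ 1<m (ℕ.<⇒≤ 1<m)

    bound : (q : ℕ) (q-prime : Prime q) → reciprocal K · q ^[ t ℕ.+ a / t ]≤ IM 2 q q-prime
    bound q q-prime
      -- The search has valid ends: at `k = 0` the value is 2, at most any prime, and at `k = q` it
      -- exceeds `q` because `q < B ^ q`.
      with k , 2Bᵏ≤q , q<2Bᵏ⁺¹ ← lastBelow (λ k → 2 ℕ.* B ℕ.^ k) q
             (ℕ.nonTrivial⇒n>1 q {{prime⇒nonTrivial q-prime}})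
             (ℕ.<-≤-trans (n<m^n 1<B q) (ℕ.m≤n*m (B ℕ.^ q) 2)) =
      reciprocal·x^[s/t]≤y K {q} {t ℕ.+ a} {t} {IM 2 q q-prime} (ℕ.≤-trans
        (growth A k a≤t m²ᵃ≤ρᵗ
          (ℕ.≤-trans (ℕ.<⇒≤ q<2Bᵏ⁺¹) (ℕ.≤-reflexive (sym (ℕ.*-assoc 2 B (B ℕ.^ k))))))
        (ℕ.*-monoʳ-≤ (K ℕ.^ t) (ℕ.^-monoˡ-≤ t (IM≥[m²ρ]^k q-prime k 2Bᵏ≤q))))

-- The residues modulo 205 and the numerical exponent

residues : Vec (Fin 205) 12
residues =
  # 0 ∷ # 2 ∷ # 8 ∷ # 14 ∷ # 77 ∷ # 79 ∷ # 85 ∷ # 96 ∷ # 103 ∷ # 109 ∷ # 111 ∷ # 181 ∷ []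

-- Decided by evaluating all 12 · 12 · 205 cases; restricting `u` to `Fin 205` loses nothing, as
-- `u * u` modulo 205 depends only on `u` modulo 205.
residues-noSquare-Fin : ∀ r r′ (u : Fin 205) →
  toℕ (lookup residues r) ≡ (toℕ (lookup residues r′) ℕ.+ toℕ u ℕ.* toℕ u) % 205 → r ≡ r′
residues-noSquare-Fin = toWitness {a? =
  Fin.all? λ r → Fin.all? λ r′ → Fin.all? λ u →
    (toℕ (lookup residues r) ℕ.≟ (toℕ (lookup residues r′) ℕ.+ toℕ u ℕ.* toℕ u) % 205)
      →-dec (r Fin.≟ r′)} tt

residues-noSquare : ∀ r r′ u →
  toℕ (lookup residues r) ≡ (toℕ (lookup residues r′) ℕ.+ u ℕ.* u) % 205 → r ≡ r′
residues-noSquare r r′ u eq = residues-noSquare-Fin r r′ (u mod 205) (trans eq reduceSquare)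
  where
  open ≡-Reasoning
  b = toℕ (lookup residues r′)
  v = toℕ (u mod 205)
  v≡u%205 : v ≡ u % 205
  v≡u%205 = Fin.toℕ-fromℕ< (m%n<n u 205)
  reduceSquare : (b ℕ.+ u ℕ.* u) % 205 ≡ (b ℕ.+ v ℕ.* v) % 205
  reduceSquare = begin
    (b ℕ.+ u ℕ.* u) % 205
      ≡⟨ %-distribˡ-+ b (u ℕ.* u) 205 ⟩
    (b % 205 ℕ.+ u ℕ.* u % 205) % 205
      ≡⟨ cong (λ x → (b % 205 ℕ.+ x) % 205) (%-distribˡ-* u u 205) ⟩
    (b % 205 ℕ.+ u % 205 ℕ.* (u % 205) % 205) % 205
      ≡⟨ cong (λ x → (b % 205 ℕ.+ x ℕ.* x % 205) % 205) v≡u%205 ⟨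
    (b % 205 ℕ.+ v ℕ.* v % 205) % 205
      ≡⟨ %-distribˡ-+ b (v ℕ.* v) 205 ⟨
    (b ℕ.+ v ℕ.* v) % 205
      ∎

p∣u²⇒p∣u : ∀ {p} → Prime p → ∀ u → p ℕ.∣ u ℕ.* u → p ℕ.∣ u
p∣u²⇒p∣u p-prime u = reduce ∘ euclidsLemma u u p-prime

-- 205 = 5 · 41 is squarefree: each of the two primes divides `u`, and so does their least common
-- multiple.
205∣u²⇒205∣u : ∀ u → 205 ℕ.∣ u ℕ.* u → 205 ℕ.∣ u
205∣u²⇒205∣u u 205∣u² = lcm-least {5} {41}
  (p∣u²⇒p∣u (toWitness {a? = prime? 5} tt) u (ℕ.∣-trans (ℕ.divides 41 refl) 205∣u²))
  (p∣u²⇒p∣u (toWitness {a? = prime? 41} tt) u (ℕ.∣-trans (ℕ.divides 5 refl) 205∣u²))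

-- The integer form of 0.2334 ≤ log 12 / (2 log 205) = 0.23341..., which is where the decimal in the
-- exponent 1.2334 comes from.
205^4668≤12^10000 : (205 ℕ.* 205) ℕ.^ 2334 ℕ.≤ 12 ℕ.^ 10000
205^4668≤12^10000 = ℕ.≤ᵇ⇒≤ _ _ tt

theorem1p2 : ∃[ c ] (0ℚ < c × ((q : ℕ) (q-prime : Prime q) → c · q ^[ 12334 / 10000 ]≤ IM 2 q q-prime))
theorem1p2 = IM-lowerBound (ℕ.≤ᵇ⇒≤ _ _ tt) (lookup residues) residues-noSquare 205∣u²⇒205∣u
  {2334} {10000} (ℕ.≤ᵇ⇒≤ _ _ tt) 205^4668≤12^10000
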